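{- $\lambda_{2,3}(3)=21$, $\lambda_{2,5}(3)=19$, $\lambda_{2,9}(3)=19$, $\lambda_{2,11}(3)=23$, $\lambda_{2,13}(3)=22$, $\lambda_{2,15}(3)=21$, $\lambda_{2,19}(3)=22$, and $\lambda_{2,21}(3)=26$.
   Context: For an odd integer $n>1$, a representation of a positive integer $k$ (with respect to $2$ and $n$) is an expression $k=\sum_{j\ge 0}\varepsilon_j(2)2^j+\sum_{j\ge 0}\varepsilon_j(n)n^j$ with only finitely many nonzero coefficients, where $\varepsilon_j(2)\in\{0,\pm1\}$ and $\varepsilon_j(n)\in\{0,\pm1,\dots,\pm\lfloor n/2\rfloor\}$ are integers. Its length is $\sum_{j\ge 0}(|\varepsilon_j(2)|+|\varepsilon_j(n)|)$. For a positive integer $h$, $\lambda_{2,n}(h)$ denotes the smallest positive integer that has a representation of length $h$ but no representation of length less than $h$. -}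

module Defs where

open import Data.Fin.Base using (toℕ)
open import Data.Integer.Base as ℤ using (ℤ; +_; 0ℤ; ∣_∣)
open import Data.Nat.Base as ℕ using (ℕ; _+_; _^_; _≤_; _<_; ⌊_/2⌋)
open import Data.Product.Base using (_×_; ∃-syntax)
open import Relation.Binary.PropositionalEquality.Core using (_≡_)
open import Relation.Nullary.Negation.Core using (¬_)
open import Relation.Unary using (Pred)
import Algebra.Definitions.RawMonoid as RawMonoidDefs

sumℕ : ℕ → (ℕ → ℕ) → ℕ
sumℕ N f = RawMonoidDefs.sum ℕ.+-0-rawMonoid {N} (λ i → f (toℕ i))

sumℤ : ℕ → (ℕ → ℤ) → ℤ
sumℤ N f = RawMonoidDefs.sum ℤ.+-0-rawMonoid {N} (λ i → f (toℕ i))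

-- All coefficients vanish from index `bound` on, so the sums over j < bound
-- are the sums over all j ≥ 0, whichever such bound is chosen.
record Representation (n k : ℕ) : Set where
  field
    ε₂ εₙ     : ℕ → ℤ
    bound     : ℕ
    ε₂-finite : ∀ j → bound ≤ j → ε₂ j ≡ 0ℤ
    εₙ-finite : ∀ j → bound ≤ j → εₙ j ≡ 0ℤ
    ε₂-digit  : ∀ j → ∣ ε₂ j ∣ ≤ 1
    εₙ-digit  : ∀ j → ∣ εₙ j ∣ ≤ ⌊ n /2⌋
    expansion : + k ≡ sumℤ bound (λ j → ε₂ j ℤ.* + (2 ^ j))
                      ℤ.+ sumℤ bound (λ j → εₙ j ℤ.* + (n ^ j))

  length : ℕ
  length = sumℕ bound (λ j → ∣ ε₂ j ∣ + ∣ εₙ j ∣)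

open Representation public using (length)

HasRepresentationOfLength : (n k h : ℕ) → Set
HasRepresentationOfLength n k h = ∃[ r ] length {n} {k} r ≡ h

HasMinimalLength : (n k h : ℕ) → Set
HasMinimalLength n k h =
  HasRepresentationOfLength n k h ×
  (∀ l → l < h → ¬ HasRepresentationOfLength n k l)

IsLeast : ∀ {ℓ} → Pred ℕ ℓ → Pred ℕ ℓ
IsLeast P m = P m × (∀ k → P k → m ≤ k)

-- λ₂ n ⟨ h ⟩≔ m  says that λ_{2,n}(h) exists and equals m.  It is a relation
-- because the existence of such a k for arbitrary n and h is not built in.
-- Only odd n > 1 and h > 0 are meaningful.
λ₂_⟨_⟩≔_ : (n h m : ℕ) → Set
λ₂ n ⟨ h ⟩≔ m = IsLeast (λ k → 0 < k × HasMinimalLength n k h) m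

{-# OPTIONS --safe #-}

-- An expression of length l is a sum of l signed powers ±2^j, ±n^j.  Modulo a
-- suitable M the powers of 2 and of n are eventually periodic, so the sums of
-- at most two of them occupy only finitely many residue classes, and for each
-- n some small M puts m = λ_{2,n}(3) outside all of these classes.  Hence m has
-- no expression of length < 3.  Expressions of length 3 for m, and of length
-- < 3 for every k < m, are found among those whose exponents are below 6.

module Submission where

open import Defs
open import Data.Integer.Base as ℤ using (ℤ; +_; -[1+_]; 0ℤ; 1ℤ; -1ℤ; ∣_∣)
open import Data.Integer.Divisibility.Signed using (_∣_; _∣?_; divides; ∣m∣n⇒∣m+n; ∣n⇒∣m*n; ∣m⇒∣-m)
import Data.Integer.Properties as ℤ
open import Data.Integer.Tactic.RingSolver using (solve-∀)
open import Data.List.Base using (List; []; _∷_; [_]; _++_; map; concatMap; filter; upTo; cartesianProduct)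
import Data.List.Relation.Unary.All as ListAll
open import Data.List.Relation.Unary.Any using (Any; here; there; any?; satisfied)
open import Data.List.Relation.Unary.Any.Properties using (++⁺ˡ; ++⁺ʳ; map⁺; applyUpTo⁺)
open import Data.Nat.Base as ℕ using (ℕ; zero; suc; _^_; _∸_; _≤_; _<_; s≤s; z≤n; ⌊_/2⌋)
import Data.Nat.Properties as ℕ
open import Data.Product.Base using (_×_; _,_; proj₁; proj₂; ∃-syntax)
open import Data.Sum.Base using (inj₁; inj₂)
open import Data.Vec.Base as Vec using (Vec; []; _∷_)
open import Data.Vec.Relation.Unary.All as VecAll using ([]; _∷_)
open import Function.Base using (_∘_)
open import Relation.Binary.PropositionalEquality using (_≡_; _≢_; refl; sym; trans; cong; subst; subst₂)
open import Relation.Nullary.Decidable using (Dec; True; toWitness; ¬?; _×-dec_; map′)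
open import Relation.Nullary.Negation using (¬_)
open import Relation.Unary using (_∪_)
open import Algebra.Properties.CommutativeSemigroup ℤ.+-commutativeSemigroup using (interchange)

-- Congruence of integers.

infix 4 _≡_[mod_] _≡?_[mod_]

-- Wrapped in a record so that unification can recover `i` and `j`, which the difference `i - j`
-- alone does not determine.
record _≡_[mod_] (i j : ℤ) (M : ℕ) : Set where
  constructor congruent
  field divides-difference : + M ∣ i ℤ.- j

open _≡_[mod_]

_≡?_[mod_] : ∀ i j M → Dec (i ≡ j [mod M ])
i ≡? j [mod M ] = map′ congruent divides-difference (+ M ∣? i ℤ.- j)

≡-mod-reflexive : ∀ {M i j} → i ≡ j → i ≡ j [mod M ]
≡-mod-reflexive {i = i} refl = congruent (divides 0ℤ (ℤ.+-inverseʳ i))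

≡-mod-trans : ∀ {M i j k} → i ≡ j [mod M ] → j ≡ k [mod M ] → i ≡ k [mod M ]
≡-mod-trans {M} {i} {j} {k} (congruent p) (congruent q) =
  congruent (subst (+ M ∣_) (telescope i j k) (∣m∣n⇒∣m+n p q))
  where
  telescope : ∀ i j k → (i ℤ.- j) ℤ.+ (j ℤ.- k) ≡ i ℤ.- k
  telescope = solve-∀

≡-mod-+ : ∀ {M i j k l} → i ≡ j [mod M ] → k ≡ l [mod M ] → i ℤ.+ k ≡ j ℤ.+ l [mod M ]
≡-mod-+ {M} {i} {j} {k} {l} (congruent p) (congruent q) =
  congruent (subst (+ M ∣_) (regroup i j k l) (∣m∣n⇒∣m+n p q))
  where
  regroup : ∀ i j k l → (i ℤ.- j) ℤ.+ (k ℤ.- l) ≡ (i ℤ.+ k) ℤ.- (j ℤ.+ l)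
  regroup = solve-∀

≡-mod-*ˡ : ∀ {M i j} a → i ≡ j [mod M ] → a ℤ.* i ≡ a ℤ.* j [mod M ]
≡-mod-*ˡ {M} {i} {j} a (congruent p) =
  congruent (subst (+ M ∣_) (factor a i j) (∣n⇒∣m*n a p))
  where
  factor : ∀ a i j → a ℤ.* (i ℤ.- j) ≡ a ℤ.* i ℤ.- a ℤ.* j
  factor = solve-∀

≡-mod-neg : ∀ {M i j} → i ≡ j [mod M ] → ℤ.- i ≡ ℤ.- j [mod M ]
≡-mod-neg {M} {i} {j} (congruent p) =
  congruent (subst (+ M ∣_) (ℤ.neg-distrib-+ i (ℤ.- j)) (∣m⇒∣-m p))

≡-mod-^-suc : ∀ {M} b i j → + (b ^ i) ≡ + (b ^ j) [mod M ] →
              + (b ^ suc i) ≡ + (b ^ suc j) [mod M ]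
≡-mod-^-suc {M} b i j p =
  subst₂ (_≡_[mod M ]) (sym (ℤ.pos-* b (b ^ i))) (sym (ℤ.pos-* b (b ^ j)))
    (≡-mod-*ˡ (+ b) p)

-- Residues of signed powers.

PowersRepeat : (M b c : ℕ) → Set
PowersRepeat M b c = ∃[ i ] i < c × + (b ^ c) ≡ + (b ^ i) [mod M ]

powersRepeat? : ∀ M b c → Dec (PowersRepeat M b c)
powersRepeat? M b c = ℕ.anyUpTo? (λ i → + (b ^ c) ≡? + (b ^ i) [mod M ]) c

-- Multiplying by `b` moves the index `i` to `suc i`; when that reaches `c`, the repetition sends it
-- back to `i₀`.
power≡early : ∀ {M b c} → PowersRepeat M b c →
              ∀ j → ∃[ i ] i < c × + (b ^ j) ≡ + (b ^ i) [mod M ]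
power≡early {c = suc c} _ zero = 0 , s≤s z≤n , ≡-mod-reflexive refl
power≡early {b = b} repeat@(i₀ , i₀<c , b^c≡b^i₀) (suc j)
  with i , i<c , b^j≡b^i ← power≡early {b = b} repeat j
  with ℕ.m≤n⇒m<n∨m≡n i<c
... | inj₁ 1+i<c = suc i , 1+i<c , ≡-mod-^-suc b j i b^j≡b^i
... | inj₂ refl  = i₀ , i₀<c , ≡-mod-trans (≡-mod-^-suc b j i b^j≡b^i) b^c≡b^i₀

data SignedPower (b : ℕ) : ℤ → Set where
  pos : ∀ j → SignedPower b (+ (b ^ j))
  neg : ∀ j → SignedPower b (ℤ.- + (b ^ j))

signedPowersUpTo : ℕ → ℕ → List ℤ
signedPowersUpTo b c = map (λ i → + (b ^ i)) (upTo c) ++ map (λ i → ℤ.- + (b ^ i)) (upTo c)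

signedPower-residue : ∀ {M b c z} → PowersRepeat M b c → SignedPower b z →
                      Any (λ a → z ≡ a [mod M ]) (signedPowersUpTo b c)
signedPower-residue {M} {b} {c} repeat (pos j)
  with i , i<c , p ← power≡early {M} {b} repeat j =
  ++⁺ˡ (map⁺ (applyUpTo⁺ _ p i<c))
signedPower-residue {M} {b} {c} repeat (neg j)
  with i , i<c , p ← power≡early {M} {b} repeat j =
  ++⁺ʳ (map _ (upTo c)) (map⁺ (applyUpTo⁺ _ (≡-mod-neg p) i<c))

-- From representations to sums counted by number of terms.

data SumOf (T : ℤ → Set) : ℕ → ℤ → Set where
  []  : SumOf T 0 0ℤ
  _∷_ : ∀ {x l z} → T x → SumOf T l z → SumOf T (suc l) (x ℤ.+ z)

sumOf-+ : ∀ {T l l′ z z′} → SumOf T l z → SumOf T l′ z′ → SumOf T (l ℕ.+ l′) (z ℤ.+ z′)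
sumOf-+ {z′ = z′} [] q = subst (SumOf _ _) (sym (ℤ.+-identityˡ z′)) q
sumOf-+ (_∷_ {x} {z = z} t p) q = subst (SumOf _ _) (sym (ℤ.+-assoc x z _)) (t ∷ sumOf-+ p q)

sumOf-replicate : ∀ {T x} → T x → ∀ k → SumOf T k (+ k ℤ.* x)
sumOf-replicate {x = x} t zero    = subst (SumOf _ 0) (sym (ℤ.*-zeroˡ x)) []
sumOf-replicate {x = x} t (suc k) =
  subst (SumOf _ (suc k)) (sym (ℤ.suc-* (+ k) x)) (t ∷ sumOf-replicate t k)

-- A coefficient `c` stands for `∣ c ∣` copies of `x` or of `- x`, according to its sign, so length
-- becomes a number of terms.
sumOf-multiple : ∀ {T x} → T x → T (ℤ.- x) → ∀ c → SumOf T ∣ c ∣ (c ℤ.* x)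
sumOf-multiple t t⁻ (+ k) = sumOf-replicate t k
sumOf-multiple {x = x} t t⁻ -[1+ k ] =
  subst (SumOf _ (suc k)) (move-sign (+ suc k) x) (sumOf-replicate t⁻ (suc k))
  where
  move-sign : ∀ c x → c ℤ.* ℤ.- x ≡ ℤ.- c ℤ.* x
  move-sign = solve-∀

-- `length` counts both bases together at each index while the expansion sums them separately;
-- `interchange` reconciles the two orders.
sumOf-sum : ∀ {T} N {f : ℕ → ℕ} (g h : ℕ → ℤ) → (∀ j → SumOf T (f j) (g j ℤ.+ h j)) →
            SumOf T (sumℕ N f) (sumℤ N g ℤ.+ sumℤ N h)
sumOf-sum zero    g h p = []
sumOf-sum (suc N) g h p =
  subst (SumOf _ _)
    (interchange (g 0) (h 0) (sumℤ N (g ∘ suc)) (sumℤ N (h ∘ suc)))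
    (sumOf-+ (p 0) (sumOf-sum N (g ∘ suc) (h ∘ suc) (p ∘ suc)))

Term : ℕ → ℤ → Set
Term n = SignedPower 2 ∪ SignedPower n

representation⇒sumOf : ∀ {n k} (r : Representation n k) → SumOf (Term n) (length r) (+ k)
representation⇒sumOf {n} r = subst (SumOf _ _) (sym expansion)
  (sumOf-sum bound (λ j → ε₂ j ℤ.* + (2 ^ j)) (λ j → εₙ j ℤ.* + (n ^ j)) λ j → sumOf-+
    (sumOf-multiple (inj₁ (pos j)) (inj₁ (neg j)) (ε₂ j))
    (sumOf-multiple (inj₂ (pos j)) (inj₂ (neg j)) (εₙ j)))
  where open Representation r

-- 0 is included so that two residues account for sums of fewer than two terms.
termResidues : (n c₂ cₙ : ℕ) → List ℤ
termResidues n c₂ cₙ = 0ℤ ∷ signedPowersUpTo 2 c₂ ++ signedPowersUpTo n cₙ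

AvoidsTwoTerms : (n m M c₂ cₙ : ℕ) → Set
AvoidsTwoTerms n m M c₂ cₙ =
  ListAll.All (λ a → ListAll.All (λ b → ¬ + m ≡ a ℤ.+ b [mod M ]) residues) residues
  where residues = termResidues n c₂ cₙ

module _ {n m M c₂ cₙ : ℕ}
         (repeat₂ : PowersRepeat M 2 c₂) (repeatₙ : PowersRepeat M n cₙ)
         (avoids : AvoidsTwoTerms n m M c₂ cₙ) where

  private
    Residue : ℤ → Set
    Residue z = Any (λ a → z ≡ a [mod M ]) (termResidues n c₂ cₙ)

    zero-residue : Residue 0ℤ
    zero-residue = here (≡-mod-reflexive refl)

    term-residue : ∀ {z} → Term n z → Residue z
    term-residue (inj₁ t) = there (++⁺ˡ (signedPower-residue {b = 2} repeat₂ t))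
    term-residue (inj₂ t) =
      there (++⁺ʳ (signedPowersUpTo 2 c₂) (signedPower-residue {b = n} repeatₙ t))

    two-residues : ∀ {x y} → Residue x → Residue y → + m ≢ x ℤ.+ y
    two-residues p q m≡x+y
      with avoids-a , x≡a ← ListAll.lookupAny avoids p
      with m≢a+b , y≡b ← ListAll.lookupAny avoids-a q =
      m≢a+b (≡-mod-trans (≡-mod-reflexive m≡x+y) (≡-mod-+ x≡a y≡b))

  twoTermSum-absent : ∀ {l z} → l < 3 → SumOf (Term n) l z → + m ≢ z
  twoTermSum-absent _ [] = two-residues zero-residue zero-residue
  twoTermSum-absent _ (t ∷ []) = two-residues (term-residue t) zero-residue
  twoTermSum-absent _ (_∷_ {x} t (_∷_ {y} u [])) m≡ =
    two-residues (term-residue t) (term-residue u)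
      (trans m≡ (cong (λ w → x ℤ.+ w) (ℤ.+-identityʳ y)))
  twoTermSum-absent (s≤s (s≤s (s≤s ()))) (_ ∷ _ ∷ _ ∷ _)

  no-short-representation : ∀ l → l < 3 → ¬ HasRepresentationOfLength n m l
  no-short-representation l l<3 (r , refl) =
    twoTermSum-absent l<3 (representation⇒sumOf r) refl

-- Explicit expansions as digit vectors.

-- The j-th entry is the pair (ε_j(2), ε_j(n)).
Digits : ℕ → Set
Digits = Vec (ℤ × ℤ)

digit : ∀ {D} → Digits D → ℕ → ℤ × ℤ
-- Zero past the end, so that `D` can serve as the bound of a representation.
digit []       _       = 0ℤ , 0ℤ
digit (d ∷ ds) zero    = d
digit (d ∷ ds) (suc j) = digit ds j

digit₂ digitₙ : ∀ {D} → Digits D → ℕ → ℤ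
digit₂ ds = proj₁ ∘ digit ds
digitₙ ds = proj₂ ∘ digit ds

digit-finite : ∀ {D} (ds : Digits D) j → D ≤ j → digit ds j ≡ (0ℤ , 0ℤ)
digit-finite []       _       _         = refl
digit-finite (d ∷ ds) (suc j) (s≤s D≤j) = digit-finite ds j D≤j

Admissible : ℕ → ℤ × ℤ → Set
Admissible n (a , b) = ∣ a ∣ ≤ 1 × ∣ b ∣ ≤ ⌊ n /2⌋

admissible? : ∀ n d → Dec (Admissible n d)
admissible? n (a , b) = ∣ a ∣ ℕ.≤? 1 ×-dec ∣ b ∣ ℕ.≤? ⌊ n /2⌋

digit-admissible : ∀ {n D} {ds : Digits D} → VecAll.All (Admissible n) ds →
                   ∀ j → Admissible n (digit ds j)
digit-admissible []       _       = z≤n , z≤n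
digit-admissible (p ∷ ps) zero    = p
digit-admissible (p ∷ ps) (suc j) = digit-admissible ps j

value : ∀ {D} → ℕ → Digits D → ℤ
value {D} n ds = sumℤ D (λ j → digit₂ ds j ℤ.* + (2 ^ j))
           ℤ.+ sumℤ D (λ j → digitₙ ds j ℤ.* + (n ^ j))

weight : ∀ {D} → Digits D → ℕ
weight {D} ds = sumℕ D (λ j → ∣ digit₂ ds j ∣ ℕ.+ ∣ digitₙ ds j ∣)

Expands : ∀ {D} → ℕ → ℕ → Digits D → Set
Expands n k ds = + k ≡ value n ds × VecAll.All (Admissible n) ds

expands? : ∀ {D} n k (ds : Digits D) → Dec (Expands n k ds)
expands? n k ds = + k ℤ.≟ value n ds ×-dec VecAll.all? (admissible? n) ds

expands⇒hasRepresentation : ∀ {n k D} {ds : Digits D} → Expands n k ds →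
                            HasRepresentationOfLength n k (weight ds)
expands⇒hasRepresentation {D = D} {ds} (k≡value , admissible) = record
  { ε₂        = digit₂ ds
  ; εₙ        = digitₙ ds
  ; bound     = D
  ; ε₂-finite = λ j D≤j → cong proj₁ (digit-finite ds j D≤j)
  ; εₙ-finite = λ j D≤j → cong proj₂ (digit-finite ds j D≤j)
  ; ε₂-digit  = proj₁ ∘ digit-admissible admissible
  ; εₙ-digit  = proj₂ ∘ digit-admissible admissible
  ; expansion = k≡value
  } , refl

-- The digit 2 is needed only for 22 = 2 · 11 when n = 11; vectors with digits
-- too large for n are discarded by expands?.
digitVectors : ∀ D w → List (Digits D)
digitVectors zero    w = [ [] ]
digitVectors (suc D) w = concatMap extend
  (filter (λ (a , b) → ∣ a ∣ ℕ.+ ∣ b ∣ ℕ.≤? w)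
          (cartesianProduct (0ℤ ∷ 1ℤ ∷ -1ℤ ∷ []) (0ℤ ∷ 1ℤ ∷ -1ℤ ∷ + 2 ∷ [])))
  where
  extend : ℤ × ℤ → List (Digits (suc D))
  -- `w` is the weight left to spend; the filter makes the truncated subtraction exact.
  extend d@(a , b) = map (d ∷_) (digitVectors D (w ∸ (∣ a ∣ ℕ.+ ∣ b ∣)))

-- The explicit test `weight ds < 3` carries the length bound, so the enumeration only supplies
-- candidates.
HasShortExpansion : (n k : ℕ) → Set
HasShortExpansion n k = Any (λ ds → Expands n k ds × weight ds < 3) (digitVectors 6 2)

hasShortExpansion? : ∀ n k → Dec (HasShortExpansion n k)
hasShortExpansion? n k = any? (λ ds → expands? n k ds ×-dec weight ds ℕ.<? 3) (digitVectors 6 2)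

-- Decidable certificates and the eight values.

Certificate : ∀ {D} (n m : ℕ) → Digits D → (M c₂ cₙ : ℕ) → Set
Certificate n m ds M c₂ cₙ =
  0 < m ×
  (Expands n m ds × weight ds ≡ 3) ×
  (∀ {k} → k < m → HasShortExpansion n k) ×
  PowersRepeat M 2 c₂ × PowersRepeat M n cₙ × AvoidsTwoTerms n m M c₂ cₙ

certificate? : ∀ {D} n m (ds : Digits D) M c₂ cₙ → Dec (Certificate n m ds M c₂ cₙ)
certificate? n m ds M c₂ cₙ =
  0 ℕ.<? m ×-dec
  (expands? n m ds ×-dec weight ds ℕ.≟ 3) ×-dec
  ℕ.allUpTo? (hasShortExpansion? n) m ×-dec
  powersRepeat? M 2 c₂ ×-dec powersRepeat? M n cₙ ×-dec
  ListAll.all? (λ a → ListAll.all? (λ b → ¬? (+ m ≡? a ℤ.+ b [mod M ])) residues) residues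
  where residues = termResidues n c₂ cₙ

certificate⇒λ₂ : ∀ {n m D} {ds : Digits D} {M c₂ cₙ} →
                 Certificate n m ds M c₂ cₙ → λ₂ n ⟨ 3 ⟩≔ m
certificate⇒λ₂ {n} {m} (0<m , (expands , weight≡3) , short , repeat₂ , repeatₙ , avoids) =
  (0<m ,
   subst (HasRepresentationOfLength n m) weight≡3 (expands⇒hasRepresentation expands) ,
   no-short-representation repeat₂ repeatₙ avoids) ,
  least
  where
  least : ∀ k → 0 < k × HasMinimalLength n k 3 → m ≤ k
  -- If `k < m`, the short expansion found for `k` contradicts its minimal length 3.
  least k (_ , _ , minimal) = ℕ.≮⇒≥ λ k<m →
    let ds , expands , weight<3 = satisfied (short k<m)
    in minimal (weight ds) weight<3 (expands⇒hasRepresentation expands)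

-- In theorem2, M is the least modulus that works, found by search, and c₂ and cₙ
-- are the numbers of distinct residues of the powers of 2 and of n modulo M.
λ₂-certified : ∀ n m {D} (ds : Digits D) M c₂ cₙ →
               {True (certificate? n m ds M c₂ cₙ)} → λ₂ n ⟨ 3 ⟩≔ m
λ₂-certified _ _ _ _ _ _ {t} = certificate⇒λ₂ (toWitness t)

-- Each witness of length 3 uses powers of 2 alone, lowest first: for example 23 = -1 + 8 + 16.
binary : ∀ {D} → Vec ℤ D → Digits D
binary = Vec.map (_, 0ℤ)

theorem2 : (λ₂ 3 ⟨ 3 ⟩≔ 21) ×
    (λ₂ 5 ⟨ 3 ⟩≔ 19) ×
    (λ₂ 9 ⟨ 3 ⟩≔ 19) ×
    (λ₂ 11 ⟨ 3 ⟩≔ 23) ×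
    (λ₂ 13 ⟨ 3 ⟩≔ 22) ×
    (λ₂ 15 ⟨ 3 ⟩≔ 21) ×
    (λ₂ 19 ⟨ 3 ⟩≔ 22) ×
    (λ₂ 21 ⟨ 3 ⟩≔ 26)
theorem2 =
  λ₂-certified 3  21 (binary (1ℤ ∷ 0ℤ ∷ 1ℤ ∷ 0ℤ ∷ 1ℤ ∷ []))  72  9 4 ,
  λ₂-certified 5  19 (binary (1ℤ ∷ 1ℤ ∷ 0ℤ ∷ 0ℤ ∷ 1ℤ ∷ []))  62  6 3 ,
  λ₂-certified 9  19 (binary (1ℤ ∷ 1ℤ ∷ 0ℤ ∷ 0ℤ ∷ 1ℤ ∷ []))  40  7 2 ,
  λ₂-certified 11 23 (binary (-1ℤ ∷ 0ℤ ∷ 0ℤ ∷ 1ℤ ∷ 1ℤ ∷ [])) 60  6 2 ,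
  λ₂-certified 13 22 (binary (0ℤ ∷ 1ℤ ∷ 1ℤ ∷ 0ℤ ∷ 1ℤ ∷ []))  112 7 4 ,
  λ₂-certified 15 21 (binary (1ℤ ∷ 0ℤ ∷ 1ℤ ∷ 0ℤ ∷ 1ℤ ∷ []))  48  6 3 ,
  λ₂-certified 19 22 (binary (0ℤ ∷ 1ℤ ∷ 1ℤ ∷ 0ℤ ∷ 1ℤ ∷ []))  72  9 2 ,
  λ₂-certified 21 26 (binary (0ℤ ∷ 1ℤ ∷ 0ℤ ∷ 1ℤ ∷ 1ℤ ∷ []))  80  8 4
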